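{- Let $X\cup\{y\}$ be a multiset of squares with side at most $\frac12$. If NFDH can pack $X$ in one bin, but cannot pack $X\cup\{y\}$ in one bin, then $a(X)>\frac{5}{16}$.
   Context: A bin is a unit square. All multisets are finite and squares have positive side. For a multiset $X$ of squares, $a(X)$ is the sum of the areas of its members; $X\cup\{y\}$ denotes $X$ with the additional member $y$. **NFDH (Next-Fit Decreasing Height).** Given a finite multiset of squares of side at most $1$, sort them by non-increasing side. Pack them in this order side by side, from the left, along the bottom of a strip of width $1$ (forming a level) until the next square does not fit horizontally (i.e. the sum of the sides in the level would exceed $1$). Then close that level and start a new level, with this square as its first item, on the horizontal line through the top of the first (tallest) square of the closed level; continue in the same way. The height of a level is the side of its first square. NFDH packs the multiset into one bin if the heights of all levels sum to at most $1$; otherwise it fails (cannot pack it). -}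

module Defs where

open import Algebra.Bundles using (CommutativeRing)
open import Algebra.Core using (Op₁; Op₂)
open import Algebra.Structures using (IsCommutativeRing)
import Algebra.Definitions.RawMonoid as RawMonoidDefs
open import Data.List.Base using (List; []; _∷_; foldr; map)
open import Data.List.NonEmpty.Base using (List⁺; [_]; _⁺∷ʳ_; head; toList)
import Data.List.Sort as Sort
open import Data.Nat.Base using (ℕ)
open import Level using (suc; _⊔_)
open import Relation.Binary.Bundles using (DecTotalOrder)
open import Relation.Binary.Core using (Rel)
import Relation.Binary.Construct.NonStrictToStrict as ToStrict
import Relation.Binary.Properties.DecTotalOrder as DecTotalOrderProperties
open import Relation.Binary.Structures using (IsDecTotalOrder)
open import Relation.Nullary.Decidable.Core using (yes; no)
open import Relation.Nullary.Negation.Core using (¬_)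

-- The standard library has no real numbers, so side lengths are taken in an
-- arbitrary linearly ordered field; classically ℝ is one.  The order is
-- decidable because next-fit branches on comparisons.

record OrderedField c ℓ₁ ℓ₂ : Set (suc (c ⊔ ℓ₁ ⊔ ℓ₂)) where
  infix  9 _⁻¹
  infix  8 -_
  infixl 7 _*_ _/_
  infixl 6 _+_
  infix  4 _≈_ _≤_ _<_
  field
    Carrier           : Set c
    _≈_               : Rel Carrier ℓ₁
    _≤_               : Rel Carrier ℓ₂
    _+_               : Op₂ Carrier
    _*_               : Op₂ Carrier
    -_                : Op₁ Carrier
    _⁻¹               : Op₁ Carrier
    0#                : Carrier
    1#                : Carrier
    isCommutativeRing : IsCommutativeRing _≈_ _+_ _*_ -_ 0# 1#
    isDecTotalOrder   : IsDecTotalOrder _≈_ _≤_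
    0≉1               : ¬ (0# ≈ 1#)
    -- The inverse is total; its value at 0# is unconstrained.
    ⁻¹-cong           : ∀ {x y} → x ≈ y → x ⁻¹ ≈ y ⁻¹
    ⁻¹-inverseʳ       : ∀ x → ¬ (x ≈ 0#) → x * x ⁻¹ ≈ 1#
    +-monoˡ-≤         : ∀ {x y} z → x ≤ y → x + z ≤ y + z
    *-nonNeg          : ∀ {x y} → 0# ≤ x → 0# ≤ y → 0# ≤ x * y

  commutativeRing : CommutativeRing c ℓ₁
  commutativeRing = record { isCommutativeRing = isCommutativeRing }

  decTotalOrder : DecTotalOrder c ℓ₁ ℓ₂
  decTotalOrder = record { isDecTotalOrder = isDecTotalOrder }

  open IsDecTotalOrder isDecTotalOrder public using (_≤?_)

  _<_ : Rel Carrier (ℓ₁ ⊔ ℓ₂)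
  _<_ = ToStrict._<_ _≈_ _≤_

  _/_ : Op₂ Carrier
  x / y = x * y ⁻¹

  fromℕ : ℕ → Carrier
  fromℕ n = n × 1#
    where open RawMonoidDefs (CommutativeRing.+-rawMonoid commutativeRing) using (_×_)

-- A square is represented by its side and a multiset of squares by a list of
-- sides in arbitrary order; X ∪ {y} is y ∷ X.

module Packing {c ℓ₁ ℓ₂} (F : OrderedField c ℓ₁ ℓ₂) where
  open OrderedField F

  sum : List Carrier → Carrier
  sum = foldr _+_ 0#

  area : List Carrier → Carrier
  area X = sum (map (λ s → s * s) X)

  sortDecreasing : List Carrier → List Carrier
  sortDecreasing =
    Sort.sort (DecTotalOrderProperties.≥-decTotalOrder decTotalOrder)

  -- The squares of a level, from left to right.
  Level : Set c
  Level = List⁺ Carrier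

  width : Level → Carrier
  width l = sum (toList l)

  height : Level → Carrier
  height = head

  -- The first argument is the level currently open.
  nextFitFrom : Level → List Carrier → List Level
  nextFitFrom l []       = l ∷ []
  nextFitFrom l (s ∷ ss) with width (l ⁺∷ʳ s) ≤? 1#
  ... | yes _ = nextFitFrom (l ⁺∷ʳ s) ss
  ... | no  _ = l ∷ nextFitFrom [ s ] ss

  nextFit : List Carrier → List Level
  nextFit []       = []
  nextFit (s ∷ ss) = nextFitFrom [ s ] ss

  nfdh : List Carrier → List Level
  nfdh X = nextFit (sortDecreasing X)

  NFDHPacks : List Carrier → Set ℓ₂
  NFDHPacks X = sum (map height (nfdh X)) ≤ 1#

{-# OPTIONS --safe #-}
module Submission where

-- If NFDH fails on x₁ ≥ x₂ ≥ … with all sides at most 1/2, then already the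
-- squares other than x₁ have area above 5/16; as y ≤ x₁, so has X.  The first
-- level contains x₂.  Let t ≤ x₂ be the height of the second level and T the
-- total height of the levels after it, so t + T > 1 − x₁ ≥ 1/2.  Charging each
-- new level to the width that its first square overflows shows that the levels
-- from the second on have area at least t² + (1 − t) T.  Hence the area without
-- x₁ exceeds 2t² + (1 − t)(1/2 − t) = 5/16 + 3 (t − 1/4)².

open import Defs
open import Algebra.Bundles using (CommutativeRing)
import Algebra.Properties.AbelianGroup as AbelianGroupProperties
import Algebra.Solver.Ring.NaturalCoefficients.Default as NaturalCoefficients
open import Data.List.Base using (List; []; _∷_; _++_; map)
open import Data.List.NonEmpty.Base using ([_]; _∷_; _⁺∷ʳ_)
open import Data.List.Relation.Binary.Permutation.Propositional using (_↭_; ↭-sym; ↭⇒↭ₛ′)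
import Data.List.Relation.Binary.Permutation.Propositional.Properties as Perm
import Data.List.Relation.Binary.Permutation.Setoid.Properties as PermSetoid
open import Data.List.Relation.Unary.All as All using (All; []; _∷_)
open import Data.List.Relation.Unary.Linked using (_∷_)
open import Data.List.Relation.Unary.Linked.Properties using (Linked⇒All)
import Data.List.Relation.Unary.Sorted.TotalOrder as SortedTotalOrder
import Data.List.Sort as Sort
open import Data.Nat.Base using (ℕ; zero; suc)
open import Data.Product.Base using (_×_; _,_; proj₁; proj₂; ∃; ∃₂)
open import Data.Sum.Base using (_⊎_; inj₁; inj₂)
open import Relation.Binary.Bundles using (DecTotalOrder)
import Relation.Binary.Properties.DecTotalOrder as DecTotalOrderProperties
open import Relation.Nullary.Decidable.Core using (yes; no)
open import Relation.Nullary.Negation.Core using (¬_; contradiction)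

-- Ordered-field arithmetic without subtraction.

module OrderedFieldProperties {c ℓ₁ ℓ₂} (F : OrderedField c ℓ₁ ℓ₂) where
  open OrderedField F
  open CommutativeRing commutativeRing public
    using ( refl; sym; trans; isEquivalence; setoid
          ; +-cong; +-congˡ; +-congʳ; +-assoc; +-comm; +-identityʳ; -‿inverseʳ
          ; *-cong; *-congˡ; *-assoc; *-comm; *-identityʳ
          ; commutativeSemiring; +-abelianGroup; +-isCommutativeMonoid)
  open DecTotalOrder decTotalOrder public
    using (total; antisym; ≤-respˡ-≈; ≤-respʳ-≈)
    renaming (refl to ≤-refl; reflexive to ≤-reflexive; trans to ≤-trans)
  open NaturalCoefficients commutativeSemiring public
    using (Polynomial; solve; con; _:=_; _:+_; _:*_)

  -- Built as a sum of ones ending in 0, so that it denotes `fromℕ n` definitionally and solved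
  -- identities match their goals.
  nat : ∀ {k} → ℕ → Polynomial k
  nat zero    = con 0
  nat (suc n) = con 1 :+ nat n

  +-mono-≤ : ∀ {x y u v} → x ≤ y → u ≤ v → x + u ≤ y + v
  +-mono-≤ {x} {y} {u} {v} x≤y u≤v = ≤-trans (+-monoˡ-≤ u x≤y)
    (≤-respˡ-≈ (+-comm u y) (≤-respʳ-≈ (+-comm v y) (+-monoˡ-≤ y u≤v)))

  +-cancelʳ-≤ : ∀ {x y} z → x + z ≤ y + z → x ≤ y
  +-cancelʳ-≤ {x} {y} z p = ≤-respˡ-≈ (drop x) (≤-respʳ-≈ (drop y) (+-monoˡ-≤ (- z) p))
    where
    drop : ∀ w → w + z + - z ≈ w
    drop w = trans (+-assoc w z (- z)) (trans (+-congˡ (-‿inverseʳ z)) (+-identityʳ w))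

  -- With a ≤ b a sum of known inequalities, this leaves a semiring identity,
  -- which the solver can decide without negation.
  ≤-by : ∀ {a b p q} → a ≤ b → p + b ≈ q + a → p ≤ q
  ≤-by {a} {b} {p} {q} a≤b eq = +-cancelʳ-≤ b
    (≤-respˡ-≈ (sym eq) (+-mono-≤ ≤-refl a≤b))

  ≤⇒∃+ : ∀ {x y} → x ≤ y → ∃ λ d → 0# ≤ d × y ≈ x + d
  ≤⇒∃+ {x} {y} x≤y = y + - x , ≤-respˡ-≈ (-‿inverseʳ x) (+-monoˡ-≤ (- x) x≤y) ,
    sym (trans (sym (+-assoc x y (- x))) (AbelianGroupProperties.xyx⁻¹≈y +-abelianGroup x y))

  -- 0 ≤ (y − x) (v − u), with the negative terms moved to the left.
  *-rearrangement : ∀ {x y u v} → x ≤ y → u ≤ v → x * v + y * u ≤ x * u + y * v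
  *-rearrangement {x} {y} {u} {v} x≤y u≤v with ≤⇒∃+ x≤y | ≤⇒∃+ u≤v
  ... | d , 0≤d , y≈x+d | e , 0≤e , v≈u+e =
    ≤-respˡ-≈ (+-cong (*-congˡ (sym v≈u+e)) (*-cong (sym y≈x+d) refl))
      (≤-respʳ-≈ (+-congˡ (*-cong (sym y≈x+d) (sym v≈u+e)))
        (≤-by (*-nonNeg 0≤d 0≤e)
          (solve 4 (λ x u d e →
             x :* (u :+ e) :+ (x :+ d) :* u :+ d :* e
             := x :* u :+ (x :+ d) :* (u :+ e) :+ con 0) refl x u d e)))

  *-monoˡ-≤ : ∀ {x y} z → 0# ≤ z → x ≤ y → z * x ≤ z * y
  *-monoˡ-≤ {x} {y} z 0≤z x≤y = ≤-by (*-rearrangement 0≤z x≤y)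
    (solve 3 (λ x y z → z :* x :+ (con 0 :* x :+ z :* y)
                        := z :* y :+ (con 0 :* y :+ z :* x)) refl x y z)

  square-mono-≤ : ∀ {x y} → 0# ≤ x → x ≤ y → x * x ≤ y * y
  square-mono-≤ {x} {y} 0≤x x≤y = ≤-trans (*-monoˡ-≤ x 0≤x x≤y)
    (≤-respˡ-≈ (*-comm y x) (*-monoˡ-≤ y (≤-trans 0≤x x≤y) x≤y))

  -- 0 ≤ (x − y)².
  2xy≤x²+y² : ∀ x y → x * y + y * x ≤ x * x + y * y
  2xy≤x²+y² x y with total x y
  ... | inj₁ x≤y = *-rearrangement x≤y x≤y
  ... | inj₂ y≤x = ≤-respˡ-≈ (+-comm _ _) (≤-respʳ-≈ (+-comm _ _) (*-rearrangement y≤x y≤x))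

  square-nonNeg : ∀ x → 0# ≤ x * x
  square-nonNeg x = ≤-by (2xy≤x²+y² x 0#)
    (solve 1 (λ x → con 0 :+ (x :* x :+ con 0 :* con 0)
                    := x :* x :+ (x :* con 0 :+ con 0 :* x)) refl x)

  0≤1 : 0# ≤ 1#
  0≤1 = ≤-respʳ-≈ (*-identityʳ 1#) (square-nonNeg 1#)

  fromℕ-nonNeg : ∀ n → 0# ≤ fromℕ n
  fromℕ-nonNeg zero    = ≤-refl
  fromℕ-nonNeg (suc n) = ≤-respˡ-≈ (+-identityʳ 0#) (+-mono-≤ 0≤1 (fromℕ-nonNeg n))

  -- If 1 + n vanished, then 0 ≤ 1 ≤ 1 + n would collapse 0 and 1.
  fromℕ[1+n]≉0 : ∀ n → ¬ (fromℕ (suc n) ≈ 0#)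
  fromℕ[1+n]≉0 n eq = 0≉1 (antisym 0≤1
    (≤-respʳ-≈ eq (≤-respˡ-≈ (+-identityʳ 1#) (+-mono-≤ ≤-refl (fromℕ-nonNeg n)))))

  fromℕ-*-/ : ∀ n x → fromℕ (suc n) * (x / fromℕ (suc n)) ≈ x
  fromℕ-*-/ n x = trans (*-comm _ _) (trans (*-assoc x _ _) (trans
    (*-congˡ (trans (*-comm _ _) (⁻¹-inverseʳ _ (fromℕ[1+n]≉0 n)))) (*-identityʳ x)))

  ≤/⇒*≤ : ∀ n {x y} → x ≤ y / fromℕ (suc n) → fromℕ (suc n) * x ≤ y
  ≤/⇒*≤ n {y = y} p = ≤-respʳ-≈ (fromℕ-*-/ n y) (*-monoˡ-≤ _ (fromℕ-nonNeg (suc n)) p)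

  -- Needs no sign for `_⁻¹`: if y ≤ x, then n y ≤ n x, and adding this to the hypothesis leaves x ≤
  -- y.
  fromℕ-*-cancelˡ-≤ : ∀ n {x y} → fromℕ (suc n) * x ≤ fromℕ (suc n) * y → x ≤ y
  fromℕ-*-cancelˡ-≤ n {x} {y} p with total x y
  ... | inj₁ x≤y = x≤y
  ... | inj₂ y≤x = ≤-by (+-mono-≤ p (*-monoˡ-≤ (fromℕ n) (fromℕ-nonNeg n) y≤x))
    (solve 3 (λ n x y → x :+ ((con 1 :+ n) :* y :+ n :* x)
                        := y :+ ((con 1 :+ n) :* x :+ n :* y)) refl (fromℕ n) x y)

-- Area bounds for next-fit levels.

module NextFit {c ℓ₁ ℓ₂} (F : OrderedField c ℓ₁ ℓ₂) where
  open OrderedField F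
  open OrderedFieldProperties F
  open Packing F
  open DecTotalOrderProperties decTotalOrder using (≥-decTotalOrder; ≥-trans; ≰⇒≥)
  open SortedTotalOrder (DecTotalOrder.totalOrder ≥-decTotalOrder) using (Sorted)

  totalHeight : List Level → Carrier
  totalHeight ls = sum (map height ls)

  sum-∷ʳ : ∀ xs s → sum (xs ++ s ∷ []) ≈ sum xs + s
  sum-∷ʳ []       s = +-comm s 0#
  sum-∷ʳ (x ∷ xs) s = trans (+-congˡ (sum-∷ʳ xs s)) (sym (+-assoc x _ s))

  width-⁺∷ʳ : ∀ l s → width (l ⁺∷ʳ s) ≈ width l + s
  width-⁺∷ʳ (x ∷ xs) = sum-∷ʳ (x ∷ xs)

  area-↭ : ∀ {X Y} → X ↭ Y → area X ≈ area Y
  area-↭ X↭Y = PermSetoid.foldr-commMonoid setoid +-isCommutativeMonoid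
    (↭⇒↭ₛ′ isEquivalence (Perm.map⁺ (λ s → s * s) X↭Y))

  -- Here g bounds the remaining squares from above and the squares already in
  -- the level from below.  The inequality says
  -- (1 − height l) T ≤ area ss + (width l − height l) g.
  laterHeight≤area : ∀ l g ss → Sorted (g ∷ ss) → All (0# ≤_) (g ∷ ss) →
    g ≤ height l → height l ≤ width l →
    ∃ λ T → 0# ≤ T × totalHeight (nextFitFrom l ss) ≈ height l + T ×
      T + height l * g ≤ area ss + width l * g + height l * T
  laterHeight≤area l g [] _ (0≤g ∷ []) _ h≤w = 0# , ≤-refl , refl ,
    ≤-by (*-monoˡ-≤ g 0≤g h≤w)
      (solve 3 (λ h w g → con 0 :+ h :* g :+ g :* w
                          := con 0 :+ w :* g :+ h :* con 0 :+ g :* h) refl (height l) (width l) g)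
  laterHeight≤area l g (s ∷ ss) (s≤g ∷ sorted) (0≤g ∷ 0≤s ∷ 0≤ss) g≤h h≤w
    with width (l ⁺∷ʳ s) ≤? 1#
  -- With w and h the width and height of `l`, induction gives the surplus (w + s - h) s: its part
  -- (w - h) s is at most (w - h) g, and the rest is the area of `s`.
  ... | yes _ =
    let (T , 0≤T , H≈ , bound) =
          laterHeight≤area (l ⁺∷ʳ s) s ss sorted (0≤s ∷ 0≤ss) (≤-trans s≤g g≤h) h≤w+s
    in T , 0≤T , H≈ ,
    ≤-by (+-mono-≤ (≤-respʳ-≈ (+-congʳ (+-congˡ (*-cong (width-⁺∷ʳ l s) refl))) bound)
                   (*-rearrangement h≤w s≤g))
      (solve 6 (λ h w g s A T →
         T :+ h :* g :+ (A :+ (w :+ s) :* s :+ h :* T :+ (h :* s :+ w :* g))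
         := s :* s :+ A :+ w :* g :+ h :* T :+ (T :+ h :* s :+ (h :* g :+ w :* s)))
       refl (height l) (width l) g s (area ss) T)
    where
    h≤w+s : height l ≤ width (l ⁺∷ʳ s)
    h≤w+s = ≤-respʳ-≈ (sym (width-⁺∷ʳ l s)) (≤-respˡ-≈ (+-identityʳ _) (+-mono-≤ h≤w 0≤s))
  -- The level `[ s ]` has no surplus, so induction gives (1 - s) T ≤ `area ss`, and s ≤ h weakens
  -- it to (1 - h) T. The overflow 1 ≤ w + s pays for the new height: (1 - h) s ≤ s² + (w - h) s ≤
  -- s² + (w - h) g.
  ... | no w+s≰1 =
    let (T , 0≤T , H≈ , bound) =
          laterHeight≤area [ s ] s ss sorted (0≤s ∷ 0≤ss) ≤-refl (≤-reflexive (sym (+-identityʳ s)))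
    in s + T , ≤-respˡ-≈ (+-identityʳ 0#) (+-mono-≤ 0≤s 0≤T) , +-congˡ H≈ ,
    ≤-by (+-mono-≤ (+-mono-≤ bound (*-rearrangement h≤w s≤g))
           (+-mono-≤ (*-monoˡ-≤ s 0≤s 1≤w+s) (*-monoˡ-≤ T 0≤T (≤-trans s≤g g≤h))))
      (solve 6 (λ h w g s A T →
         s :+ T :+ h :* g :+ (A :+ (s :+ con 0) :* s :+ s :* T :+ (h :* s :+ w :* g)
           :+ (s :* (w :+ s) :+ T :* h))
         := s :* s :+ A :+ w :* g :+ h :* (s :+ T)
           :+ (T :+ s :* s :+ (h :* g :+ w :* s) :+ (s :* con 1 :+ T :* s)))
       refl (height l) (width l) g s (area ss) T)
    where
    1≤w+s : 1# ≤ width l + s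
    1≤w+s = ≤-respʳ-≈ (width-⁺∷ʳ l s) (≰⇒≥ w+s≰1)

  -- t is the height of the level opened next, and T that of all levels after it.
  oneLevel⊎area-bound : ∀ l g ss → Sorted (g ∷ ss) → All (0# ≤_) (g ∷ ss) →
    totalHeight (nextFitFrom l ss) ≈ height l ⊎
    ∃₂ λ t T → t ≤ g × 0# ≤ t × totalHeight (nextFitFrom l ss) ≈ height l + (t + T) ×
      t * t + T ≤ area ss + t * T
  oneLevel⊎area-bound l g [] _ _ = inj₁ (+-identityʳ _)
  oneLevel⊎area-bound l g (s ∷ ss) (s≤g ∷ sorted) (0≤g ∷ 0≤s ∷ 0≤ss)
    with width (l ⁺∷ʳ s) ≤? 1#
  -- Here t = s. Width equals height in `[ s ]`, so (1 - s) T ≤ `area ss`; the square `s` itself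
  -- adds t².
  ... | no _ =
    let (T , _ , H≈ , bound) =
          laterHeight≤area [ s ] s ss sorted (0≤s ∷ 0≤ss) ≤-refl (≤-reflexive (sym (+-identityʳ s)))
    in inj₂ (s , T , s≤g , 0≤s , +-congˡ H≈ ,
    ≤-by bound
      (solve 3 (λ s A T →
         s :* s :+ T :+ (A :+ (s :+ con 0) :* s :+ s :* T)
         := s :* s :+ A :+ s :* T :+ (T :+ s :* s)) refl s (area ss) T))
  ... | yes _ with oneLevel⊎area-bound (l ⁺∷ʳ s) s ss sorted (0≤s ∷ 0≤ss)
  ...   | inj₁ H≈ = inj₁ H≈
  -- The area of a square on the first level is simply dropped.
  ...   | inj₂ (t , T , t≤s , 0≤t , H≈ , bound) = inj₂ (t , T , ≤-trans t≤s s≤g , 0≤t , H≈ ,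
    ≤-by (+-mono-≤ bound (square-nonNeg s))
      (solve 4 (λ s A t T →
         t :* t :+ T :+ (A :+ t :* T :+ s :* s)
         := s :* s :+ A :+ t :* T :+ (t :* t :+ T :+ con 0)) refl s (area ss) t T))

  -- From (1 − 2t) (2 (t + T) − 1) ≥ 0 and 3 (4t − 1)² ≥ 0.
  16*area≤5⇒height≤1 : ∀ {x₁ x₂ t T A} → fromℕ 2 * x₁ ≤ 1# → 0# ≤ t → t ≤ x₁ → t ≤ x₂ →
    t * t + T ≤ A + t * T → fromℕ 16 * (x₂ * x₂ + A) ≤ fromℕ 5 → x₁ + (t + T) ≤ 1#
  16*area≤5⇒height≤1 {x₁} {x₂} {t} {T} {A} 2x₁≤1 0≤t t≤x₁ t≤x₂ bound 16a≤5
    with total (x₁ + (t + T)) 1#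
  ... | inj₁ H≤1 = H≤1
  -- Even a height assumed to be at least 1 turns out to be at most 1. The area hypotheses give 5 ≥
  -- 32t² + 16 (1 - t) T, and the right side is 4 (1 - 2t) (2 (t + T) - 1) + 3 (4t - 1)² + 8 (t + T)
  -- + 1. So 8 (t + T) ≤ 4, while 8 x₁ ≤ 4.
  ... | inj₂ 1≤H = fromℕ-*-cancelˡ-≤ 7 (≤-by
    (+-mono-≤ (+-mono-≤ (+-mono-≤ 16a≤5 (16*-mono bound)) (16*-mono (square-mono-≤ 0≤t t≤x₂)))
      (+-mono-≤ (+-mono-≤ (4*-mono (*-rearrangement 2t≤1 1≤2[t+T])) (4*-mono 2x₁≤1))
        (*-monoˡ-≤ (fromℕ 3) (fromℕ-nonNeg 3) (2xy≤x²+y² (fromℕ 4 * t) 1#))))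
    (solve 5 (λ x₁ x₂ t T A →
       nat 8 :* (x₁ :+ (t :+ T))
       :+ (nat 5 :+ nat 16 :* (A :+ t :* T) :+ nat 16 :* (x₂ :* x₂)
         :+ (nat 4 :* (nat 2 :* t :* con 1 :+ con 1 :* (nat 2 :* (t :+ T))) :+ nat 4 :* con 1
           :+ nat 3 :* (nat 4 :* t :* (nat 4 :* t) :+ con 1 :* con 1)))
       := nat 8 :* con 1
       :+ (nat 16 :* (x₂ :* x₂ :+ A) :+ nat 16 :* (t :* t :+ T) :+ nat 16 :* (t :* t)
         :+ (nat 4 :* (nat 2 :* t :* (nat 2 :* (t :+ T)) :+ con 1 :* con 1) :+ nat 4 :* (nat 2 :* x₁)
           :+ nat 3 :* (nat 4 :* t :* con 1 :+ con 1 :* (nat 4 :* t)))))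
     refl x₁ x₂ t T A))
    where
    4*-mono : ∀ {x y} → x ≤ y → fromℕ 4 * x ≤ fromℕ 4 * y
    4*-mono = *-monoˡ-≤ (fromℕ 4) (fromℕ-nonNeg 4)
    16*-mono : ∀ {x y} → x ≤ y → fromℕ 16 * x ≤ fromℕ 16 * y
    16*-mono = *-monoˡ-≤ (fromℕ 16) (fromℕ-nonNeg 16)
    2*-mono : ∀ {x y} → x ≤ y → fromℕ 2 * x ≤ fromℕ 2 * y
    2*-mono = *-monoˡ-≤ (fromℕ 2) (fromℕ-nonNeg 2)
    2t≤1 : fromℕ 2 * t ≤ 1#
    2t≤1 = ≤-trans (2*-mono t≤x₁) 2x₁≤1
    1≤2[t+T] : 1# ≤ fromℕ 2 * (t + T)
    1≤2[t+T] = ≤-by (+-mono-≤ (2*-mono 1≤H) 2x₁≤1)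
      (solve 2 (λ x₁ u → con 1 :+ (nat 2 :* (x₁ :+ u) :+ con 1)
                         := nat 2 :* u :+ (nat 2 :* con 1 :+ nat 2 :* x₁)) refl x₁ (t + T))

  -- Packing sorted and unsorted inputs.

  nextFit-sorted-packs : ∀ x xs → Sorted (x ∷ xs) → All (0# ≤_) (x ∷ xs) →
    fromℕ 2 * x ≤ 1# → fromℕ 16 * area xs ≤ fromℕ 5 → totalHeight (nextFit (x ∷ xs)) ≤ 1#
  nextFit-sorted-packs x₁ xs sorted (0≤x₁ ∷ 0≤xs) 2x₁≤1 16a≤5 = go xs sorted 0≤xs 16a≤5
    where
    2x₁≈x₁+x₁ : fromℕ 2 * x₁ ≈ x₁ + x₁
    2x₁≈x₁+x₁ = solve 1 (λ x → nat 2 :* x := x :+ x) refl x₁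
    x₁≤1 : x₁ ≤ 1#
    x₁≤1 = ≤-trans (≤-respˡ-≈ (+-identityʳ x₁) (+-mono-≤ ≤-refl 0≤x₁)) (≤-respˡ-≈ 2x₁≈x₁+x₁ 2x₁≤1)
    go : ∀ xs → Sorted (x₁ ∷ xs) → All (0# ≤_) xs → fromℕ 16 * area xs ≤ fromℕ 5 →
         totalHeight (nextFit (x₁ ∷ xs)) ≤ 1#
    go []        _                _             _     = ≤-respˡ-≈ (sym (+-identityʳ x₁)) x₁≤1
    go (x₂ ∷ xs) (x₂≤x₁ ∷ sorted) (0≤x₂ ∷ 0≤xs) 16a≤5 with width ([ x₁ ] ⁺∷ʳ x₂) ≤? 1#
    -- Two sides of at most 1/2 always fit side by side.
    ... | no w≰1 = contradiction
      (≤-trans (+-mono-≤ ≤-refl (≤-respˡ-≈ (sym (+-identityʳ x₂)) x₂≤x₁)) (≤-respˡ-≈ 2x₁≈x₁+x₁ 2x₁≤1)) w≰1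
    ... | yes _ with oneLevel⊎area-bound ([ x₁ ] ⁺∷ʳ x₂) x₂ xs sorted (0≤x₂ ∷ 0≤xs)
    ...   | inj₁ H≈x₁ = ≤-respˡ-≈ (sym H≈x₁) x₁≤1
    ...   | inj₂ (t , T , t≤x₂ , 0≤t , H≈ , bound) = ≤-respˡ-≈ (sym H≈)
      (16*area≤5⇒height≤1 2x₁≤1 0≤t (≤-trans t≤x₂ x₂≤x₁) t≤x₂ bound 16a≤5)

  area≤5/16⇒NFDHPacks : ∀ X y → All (λ s → (0# < s) × (s ≤ fromℕ 1 / fromℕ 2)) (y ∷ X) →
    area X ≤ fromℕ 5 / fromℕ 16 → NFDHPacks (y ∷ X)
  area≤5/16⇒NFDHPacks X y sides a≤5/16 =
    go (sortDecreasing (y ∷ X)) (sort-↗ (y ∷ X)) (sort-↭ (y ∷ X))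
    where
    open Sort ≥-decTotalOrder using (sort-↗; sort-↭)
    go : ∀ ys → Sorted ys → ys ↭ y ∷ X → totalHeight (nextFit ys) ≤ 1#
    -- No permutation of `y ∷ X` is empty, but the bound holds here anyway.
    go []       _      _     = 0≤1
    go (x ∷ xs) sorted ys↭yX = nextFit-sorted-packs x xs sorted
      (All.map (λ s → proj₁ (proj₁ s)) sides′)
      (≤-respʳ-≈ (+-identityʳ 1#) (≤/⇒*≤ 1 (proj₂ (All.head sides′))))
      (≤/⇒*≤ 15 (≤-trans area-xs≤area-X a≤5/16))
      where
      sides′ = Perm.All-resp-↭ (↭-sym ys↭yX) sides
      y≤x : y ≤ x
      y≤x = All.head (Perm.All-resp-↭ ys↭yX (Linked⇒All ≥-trans ≤-refl sorted))
      -- Both lists arise from the same multiset, one by removing the largest square `x` and the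
      -- other by removing `y`.
      area-xs≤area-X : area xs ≤ area X
      area-xs≤area-X = ≤-by
        (+-mono-≤ (≤-reflexive (area-↭ ys↭yX)) (square-mono-≤ (proj₁ (proj₁ (All.head sides))) y≤x))
        (solve 4 (λ x y A B → A :+ (y :* y :+ B :+ x :* x) := B :+ (x :* x :+ A :+ y :* y))
           refl x y (area xs) (area X))

lemma3p3 : ∀ {c ℓ₁ ℓ₂} (F : OrderedField c ℓ₁ ℓ₂) →
    let open OrderedField F
        open Packing F
    in (X : List Carrier) (y : Carrier) →
       All (λ s → (0# < s) × (s ≤ fromℕ 1 / fromℕ 2)) (y ∷ X) →
       NFDHPacks X →
       ¬ NFDHPacks (y ∷ X) →
       fromℕ 5 / fromℕ 16 < area X
lemma3p3 F X y sides _ ¬packs =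
  ≰⇒> λ a≤5/16 → ¬packs (area≤5/16⇒NFDHPacks X y sides a≤5/16)
  where
  open DecTotalOrderProperties (OrderedField.decTotalOrder F) using (≰⇒>)
  open NextFit F
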